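{- Every convex subset $\mathcal{C}$ of $\mathcal{B}(n)$ has a partition into exactly $w(\mathcal{C})$ skipless chains.
   Context: $\mathcal{B}(n)$ is the family of all subsets of $[n]=\{1,\dots,n\}$ ordered by inclusion. $\mathcal{C} \subseteq \mathcal{B}(n)$ is convex if $X, Y \in \mathcal{C}$ and $X \subseteq Z \subseteq Y$ imply $Z \in \mathcal{C}$. The width $w(\mathcal{C})$ is the maximum size of an antichain in $\mathcal{C}$. A chain $X_1 \subset X_2 \subset \cdots \subset X_m$ is skipless if $|X_{j+1}| = |X_j| + 1$ for every $j$ (i.e. consecutive elements are covering pairs). Such a partition is called an SD-partition. -}

module Defs where

open import Data.Nat using (ℕ; suc; _≤_)
open import Data.Bool using (Bool; true)
open import Data.Fin.Subset using (Subset; _⊆_; ∣_∣)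
open import Data.List using (List; []; _∷_; length; concat)
open import Data.List.Membership.Propositional using (_∈_)
open import Data.List.Relation.Unary.Unique.Propositional using (Unique)
open import Data.Product using (Σ; _×_)
open import Function.Bundles using (_⇔_)
open import Relation.Binary.PropositionalEquality using (_≡_)

Family : ℕ → Set
Family n = Subset n → Bool

_∈𝒞_ : ∀ {n} → Subset n → Family n → Set
X ∈𝒞 C = C X ≡ true

Convex : ∀ {n} → Family n → Set
Convex {n} C = (X Y Z : Subset n) → X ∈𝒞 C → Y ∈𝒞 C → X ⊆ Z → Z ⊆ Y → Z ∈𝒞 C

data Skipless {n} : List (Subset n) → Set where
  single : ∀ X → Skipless (X ∷ [])
  cons   : ∀ X Y xs → X ⊆ Y → ∣ Y ∣ ≡ suc ∣ X ∣ → Skipless (Y ∷ xs) → Skipless (X ∷ Y ∷ xs)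

IsAntichain : ∀ {n} → Family n → List (Subset n) → Set
IsAntichain C A = Unique A × (∀ {X} → X ∈ A → X ∈𝒞 C)
                  × (∀ {X Y} → X ∈ A → Y ∈ A → X ⊆ Y → X ≡ Y)

IsWidth : ∀ {n} → Family n → ℕ → Set
IsWidth C w = Σ _ (λ A → IsAntichain C A × length A ≡ w)
              × (∀ A → IsAntichain C A → length A ≤ w)

IsSDPartition : ∀ {n} → Family n → List (List (Subset n)) → Set
IsSDPartition C Ps = (∀ {P} → P ∈ Ps → Skipless P)
                     × Unique (concat Ps)
                     × (∀ X → (X ∈ concat Ps) ⇔ (X ∈𝒞 C))

{-# OPTIONS --safe #-}
module Submission where

-- Let A be a maximum antichain of C. It suffices to match every element of C
-- strictly above A injectively to one of its lower covers in C lying above or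
-- in A, and dually below A; the chains through the elements of A then partition C.
-- If the upper matching fails, Hall's theorem gives a set T of one rank whose
-- lower covers V are matched upwards into T, missing some t₀. By the diamond
-- property such an upward matching propagates: the lower covers of V are matched
-- into V, and so on down. Following these matchings upwards sends the elements of
-- A below T injectively into T ∖ {t₀}, so exchanging them for T enlarges A.

open import Defs
open import Data.Nat using (ℕ; zero; suc; _+_; _≤_; _<_; z≤n; s≤s; s≤s⁻¹)
open import Data.Nat.Properties using (≤-refl; ≤-trans; ≤-reflexive; <-irrefl; <-trans; ≤-total; <⇒≢; +-suc; suc-injective; m≤n⇒∃[o]m+o≡n; +-comm) renaming (_≟_ to _≟ℕ_)
open import Data.Bool using (true; false)
import Data.Bool as Bool
open import Data.Vec using ([]; _∷_; here; there)
open import Data.Vec.Properties using (≡-dec; ∷-injectiveʳ)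
open import Data.Fin.Subset using (Subset; inside; outside; _⊆_; ∣_∣; ∁; _∩_; _∪_)
open import Data.Fin.Subset.Properties using (⊆-refl; ⊆-trans; ⊆-antisym; _⊆?_; out⊆; s⊆s; drop-∷-⊆)
open import Data.List using (List; []; _∷_; length; _++_; _ʳ++_; concat; map; filter; cartesianProduct)
open import Data.List.Properties using (length-++; length-map; filter-notAll)
open import Data.List.Membership.Propositional using (_∈_; _∉_; find; lose)
open import Data.List.Membership.Propositional.Properties using (∈-∃++; ∈-++⁺ˡ; ∈-++⁺ʳ; ∈-++⁻; ∈-map⁺; ∈-map⁻; ∈-filter⁺; ∈-filter⁻; ∈-concat⁺′; ∈-concat⁻′; ∈-cartesianProduct⁺; ∈-cartesianProduct⁻)
open import Data.List.Relation.Binary.Disjoint.Propositional using (Disjoint)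
open import Data.List.Relation.Unary.All as All using (All; []; _∷_)
open import Data.List.Relation.Unary.Any using (Any; here; there; any?)
open import Data.List.Relation.Unary.AllPairs as AllPairs using (AllPairs; []; _∷_)
open import Data.List.Relation.Unary.Linked as Linked using (Linked; [-]; _∷_)
open import Data.List.Relation.Unary.Linked.Properties using (Linked⇒AllPairs)
open import Data.List.Relation.Unary.Unique.Propositional using (Unique)
import Data.List.Relation.Unary.Unique.Propositional.Properties as Unique
import Data.List.Membership.DecPropositional as DecMembership
open import Data.Product using (Σ; ∃; _×_; _,_; proj₁; proj₂)
open import Data.Sum using (_⊎_; inj₁; inj₂)
open import Data.Empty using (⊥; ⊥-elim)
open import Function using (_∘_; flip)
open import Function.Bundles using (mk⇔)
open import Relation.Binary using (DecidableEquality; Decidable)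
open import Relation.Binary.PropositionalEquality using (_≡_; _≢_; refl; sym; trans; cong; subst)
open import Relation.Nullary using (¬_; Dec; yes; no)
open import Relation.Nullary.Decidable using (_×-dec_; ¬?; map′)

-- Counting along an injective relation.

∉⇒All≢ : {A : Set} {x : A} {xs : List A} → x ∉ xs → All (x ≢_) xs
∉⇒All≢ x∉xs = All.tabulate λ y∈xs x≡y → x∉xs (subst (_∈ _) (sym x≡y) y∈xs)

-- Delete from `ys` one element related to `x`; by injectivity the elements chosen for the rest of
-- `xs` survive the deletion. A relation replaces a function so that injectivity can be proved by
-- cases on how an image arose.
length-≤-of-injective-relation :
  {A B : Set} (R : A → B → Set) (xs : List A) (ys : List B) → Unique xs →
  (∀ {x} → x ∈ xs → ∃ λ y → y ∈ ys × R x y) →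
  (∀ {x x′ y} → x ∈ xs → x′ ∈ xs → R x y → R x′ y → x ≡ x′) →
  length xs ≤ length ys
length-≤-of-injective-relation R [] ys u total inj = z≤n
length-≤-of-injective-relation R (x ∷ xs) ys (x∉xs ∷ u) total inj
  with y , y∈ys , Rxy ← total (here refl)
  with bs , cs , refl ← ∈-∃++ y∈ys =
  ≤-trans (s≤s (length-≤-of-injective-relation R xs (bs ++ cs) u total′
                  (λ p q → inj (there p) (there q))))
          (≤-reflexive (sym length-remove))
  where
  length-remove : length (bs ++ y ∷ cs) ≡ suc (length (bs ++ cs))
  length-remove = trans (length-++ bs)
    (trans (+-suc (length bs) (length cs)) (cong suc (sym (length-++ bs))))

  total′ : ∀ {x′} → x′ ∈ xs → ∃ λ y′ → y′ ∈ bs ++ cs × R x′ y′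
  total′ x′∈xs with y′ , y′∈ys , Rx′y′ ← total (there x′∈xs) | ∈-++⁻ bs y′∈ys
  ... | inj₁ y′∈bs = y′ , ∈-++⁺ˡ y′∈bs , Rx′y′
  ... | inj₂ (there y′∈cs) = y′ , ∈-++⁺ʳ bs y′∈cs , Rx′y′
  ... | inj₂ (here refl) =
    ⊥-elim (All.lookup x∉xs x′∈xs (inj (here refl) (there x′∈xs) Rxy Rx′y′))

-- Hall's theorem by alternating paths.

record Matching {E : Set} (R : E → E → Set) (xs ys : List E) : Set where
  field
    -- Total on `E` with arbitrary values outside `xs`, so a matching restricts to fewer elements
    -- without changing `match`.
    match     : E → E
    match-∈   : ∀ {x} → x ∈ xs → match x ∈ ys
    match-R   : ∀ {x} → x ∈ xs → R x (match x)
    injective : ∀ {x x′} → x ∈ xs → x′ ∈ xs → match x ≡ match x′ → x ≡ x′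

-- A minimal violator of Hall's condition: the neighbours of deficit ∷ matched
-- are exactly as many as the elements of matched.
record Violator {E : Set} (R : E → E → Set) (xs ys : List E) : Set where
  field
    deficit   : E
    matched   : List E
    deficit∈  : deficit ∈ xs
    matched⊆  : ∀ {x} → x ∈ matched → x ∈ xs
    unique    : Unique (deficit ∷ matched)
    matching  : Matching R matched ys
    saturated : ∀ {x y} → x ∈ deficit ∷ matched → y ∈ ys → R x y →
                y ∈ map (Matching.match matching) matched

module Finite {E : Set} (_≟_ : DecidableEquality E) where

  open DecMembership _≟_ using (_∈?_)

  update : (E → E) → E → E → E → E
  update f r v x with x ≟ r
  ... | yes _ = v
  ... | no  _ = f x

  update-≢ : ∀ f {r} v {x} → x ≢ r → update f r v x ≡ f x
  update-≢ f {r} v {x} x≢r with x ≟ r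
  ... | yes x≡r = ⊥-elim (x≢r x≡r)
  ... | no _ = refl

  choice : {R : E → E → Set} (xs : List E) → (∀ {x} → x ∈ xs → ∃ (R x)) →
           Σ (E → E) λ f → ∀ {x} → x ∈ xs → R x (f x)
  choice {R} xs h = f , spec
    where
    f : E → E
    f x with x ∈? xs
    ... | yes p = proj₁ (h p)
    -- An arbitrary value: only members of `xs` matter.
    ... | no _ = x

    spec : ∀ {x} → x ∈ xs → R x (f x)
    spec {x} x∈xs with x ∈? xs
    ... | yes p = proj₂ (h p)
    ... | no x∉xs = ⊥-elim (x∉xs x∈xs)

  module Augment {R : E → E → Set} (R? : Decidable R) {ys xs : List E}
                 (M : Matching R xs ys) {x₀ : E} (x₀∉xs : x₀ ∉ xs) where

    open Matching M

    -- The result of flipping an alternating path from x₀ to r.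
    record Rerooted (reached : List E) (r : E) : Set where
      field
        f         : E → E
        f-∈       : ∀ {x} → x ∈ x₀ ∷ xs → x ≢ r → f x ∈ map match xs
        f-R       : ∀ {x} → x ∈ x₀ ∷ xs → x ≢ r → R x (f x)
        f-inj     : ∀ {x x′} → x ∈ x₀ ∷ xs → x′ ∈ x₀ ∷ xs → x ≢ r → x′ ≢ r → f x ≡ f x′ → x ≡ x′
        unchanged : ∀ {x} → x ∉ x₀ ∷ reached → f x ≡ match x

    reroot-here : Rerooted [] x₀
    reroot-here = record
      { f = match
      ; f-∈ = λ p q → ∈-map⁺ match (in-xs p q)
      ; f-R = λ p q → match-R (in-xs p q)
      ; f-inj = λ p p′ q q′ → injective (in-xs p q) (in-xs p′ q′)
      ; unchanged = λ _ → refl }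
      where
      in-xs : ∀ {x} → x ∈ x₀ ∷ xs → x ≢ x₀ → x ∈ xs
      in-xs (here eq) q = ⊥-elim (q eq)
      in-xs (there p) q = p

    -- Give `r` the partner of `x`, so that `x` becomes the vertex left out. As `x` is not yet
    -- reached, `unchanged` says that `f x` is still `match x`, and injectivity of `f` shows that no
    -- other vertex uses this value.
    reroot-step : ∀ {reached r x} → r ∈ x₀ ∷ reached → Rerooted reached r →
                  x ∈ xs → x ∉ x₀ ∷ reached → R r (match x) →
                  Rerooted (x ∷ reached) x
    reroot-step {reached} {r} {x} r∈ N x∈xs x∉ Rrv = record
      { f = g ; f-∈ = g-∈ ; f-R = g-R ; f-inj = g-inj ; unchanged = g-unchanged }
      where
      open Rerooted N
      g = update f r (match x)

      x≢r : x ≢ r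
      x≢r refl = x∉ r∈

      g-∈ : ∀ {z} → z ∈ x₀ ∷ xs → z ≢ x → g z ∈ map match xs
      g-∈ {z} z∈ z≢x with z ≟ r
      ... | yes _ = ∈-map⁺ match x∈xs
      ... | no z≢r = f-∈ z∈ z≢r

      g-R : ∀ {z} → z ∈ x₀ ∷ xs → z ≢ x → R z (g z)
      g-R {z} z∈ z≢x with z ≟ r
      ... | yes refl = Rrv
      ... | no z≢r = f-R z∈ z≢r

      fresh : ∀ {z} → z ∈ x₀ ∷ xs → z ≢ x → z ≢ r → f z ≢ match x
      fresh z∈ z≢x z≢r eq =
        z≢x (f-inj z∈ (there x∈xs) z≢r x≢r (trans eq (sym (unchanged x∉))))

      g-inj : ∀ {z z′} → z ∈ x₀ ∷ xs → z′ ∈ x₀ ∷ xs → z ≢ x → z′ ≢ x → g z ≡ g z′ → z ≡ z′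
      g-inj {z} {z′} z∈ z′∈ z≢x z′≢x eq with z ≟ r | z′ ≟ r
      ... | yes refl | yes refl = refl
      ... | yes refl | no z′≢r = ⊥-elim (fresh z′∈ z′≢x z′≢r (sym eq))
      ... | no z≢r | yes refl = ⊥-elim (fresh z∈ z≢x z≢r eq)
      ... | no z≢r | no z′≢r = f-inj z∈ z′∈ z≢r z′≢r eq

      widen : ∀ {z} → z ∈ x₀ ∷ reached → z ∈ x₀ ∷ x ∷ reached
      widen (here p) = here p
      widen (there p) = there (there p)

      g-unchanged : ∀ {z} → z ∉ x₀ ∷ x ∷ reached → g z ≡ match z
      g-unchanged z∉ = trans (update-≢ f (match x) λ { refl → z∉ (widen r∈) })
                             (unchanged (z∉ ∘ widen))

    rerooted-weaken : ∀ {reached x r} → Rerooted reached r → Rerooted (x ∷ reached) r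
    rerooted-weaken N = record
      { Rerooted N
      ; unchanged = λ z∉ → Rerooted.unchanged N
          λ { (here p) → z∉ (here p) ; (there p) → z∉ (there (there p)) } }

    -- The left-out vertex `r` takes `v`. All other values of `f` lie in `map match xs`, which does
    -- not contain `v`, so nothing collides.
    augment : ∀ {reached r v} → Rerooted reached r → v ∈ ys → v ∉ map match xs → R r v →
              Matching R (x₀ ∷ xs) ys
    augment {reached} {r} {v} N v∈ys v∉ Rrv = record
      { match = g ; match-∈ = g-∈ ; match-R = g-R ; injective = g-inj }
      where
      open Rerooted N
      g = update f r v

      g-∈ : ∀ {z} → z ∈ x₀ ∷ xs → g z ∈ ys
      g-∈ {z} z∈ with z ≟ r
      ... | yes _ = v∈ys
      ... | no z≢r with x , x∈xs , eq ← ∈-map⁻ match (f-∈ z∈ z≢r) =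
        subst (_∈ ys) (sym eq) (match-∈ x∈xs)

      g-R : ∀ {z} → z ∈ x₀ ∷ xs → R z (g z)
      g-R {z} z∈ with z ≟ r
      ... | yes refl = Rrv
      ... | no z≢r = f-R z∈ z≢r

      g-inj : ∀ {z z′} → z ∈ x₀ ∷ xs → z′ ∈ x₀ ∷ xs → g z ≡ g z′ → z ≡ z′
      g-inj {z} {z′} z∈ z′∈ eq with z ≟ r | z′ ≟ r
      ... | yes refl | yes refl = refl
      ... | yes refl | no z′≢r = ⊥-elim (v∉ (subst (_∈ _) (sym eq) (f-∈ z′∈ z′≢r)))
      ... | no z≢r | yes refl = ⊥-elim (v∉ (subst (_∈ _) eq (f-∈ z∈ z≢r)))
      ... | no z≢r | no z′≢r = f-inj z∈ z′∈ z≢r z′≢r eq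

    -- `reached` holds the vertices found by alternating paths from `x₀`, and `rest` contains all
    -- others of `xs`. If every neighbour of `x₀ ∷ reached` is a partner of `reached`, this is a
    -- violator. Otherwise take a new neighbour `v`: if it is free, the path to it is flipped; if
    -- not, its partner joins `reached` and leaves `rest`, whose length is bounded by the fuel.
    search : ∀ fuel reached rest → length rest ≤ fuel →
             (∀ {x} → x ∈ reached → x ∈ xs) → Unique reached →
             (∀ {x} → x ∈ xs → x ∈ reached ⊎ x ∈ rest) →
             (∀ {r} → r ∈ x₀ ∷ reached → Rerooted reached r) →
             Matching R (x₀ ∷ xs) ys ⊎ Violator R (x₀ ∷ xs) ys
    search fuel reached rest bound reached⊆ uniq cover reroot
      with any? (λ r → any? (λ v → R? r v ×-dec ¬? (v ∈? map match reached)) ys) (x₀ ∷ reached)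
    ... | no stuck = inj₂ (record
      { deficit = x₀
      ; matched = reached
      ; deficit∈ = here refl
      ; matched⊆ = there ∘ reached⊆
      ; unique = ∉⇒All≢ (x₀∉xs ∘ reached⊆) ∷ uniq
      ; matching = record
          { match = match
          ; match-∈ = match-∈ ∘ reached⊆
          ; match-R = match-R ∘ reached⊆
          ; injective = λ p q → injective (reached⊆ p) (reached⊆ q) }
      ; saturated = saturated′ })
      where
      saturated′ : ∀ {x y} → x ∈ x₀ ∷ reached → y ∈ ys → R x y → y ∈ map match reached
      saturated′ {x} {y} x∈ y∈ Rxy with y ∈? map match reached
      ... | yes p = p
      ... | no y∉ = ⊥-elim (stuck (lose x∈ (lose y∈ (Rxy , y∉))))
    ... | yes found
      with r , r∈ , found′ ← find found
      with v , v∈ys , Rrv , v∉ ← find found′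
      with v ∈? map match xs
    ... | no v-free = inj₁ (augment (reroot r∈) v∈ys v-free Rrv)
    ... | yes v-used
      with x , x∈xs , refl ← ∈-map⁻ match v-used
      with cover x∈xs
    ... | inj₁ x∈reached = ⊥-elim (v∉ (∈-map⁺ match x∈reached))
    search zero reached (_ ∷ _) () _ _ _ _ | yes _ | yes _ | inj₂ _
    search (suc fuel) reached rest bound reached⊆ uniq cover reroot
      | yes _ | yes _ | inj₂ x∈rest =
      search fuel (x ∷ reached) (filter (λ z → ¬? (z ≟ x)) rest)
        (s≤s⁻¹ (≤-trans (filter-notAll (λ z → ¬? (z ≟ x)) rest (lose x∈rest λ x≢x → x≢x refl)) bound))
        (λ { (here refl) → x∈xs ; (there p) → reached⊆ p })
        (∉⇒All≢ (v∉ ∘ ∈-map⁺ match) ∷ uniq)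
        cover′
        (λ { (here refl) → rerooted-weaken (reroot (here refl))
           ; (there (here refl)) → reroot-step r∈ (reroot r∈) x∈xs x∉ Rrv
           ; (there (there p)) → rerooted-weaken (reroot (there p)) })
      where
      x∉ : x ∉ x₀ ∷ reached
      x∉ (here refl) = x₀∉xs x∈xs
      x∉ (there p) = v∉ (∈-map⁺ match p)

      cover′ : ∀ {z} → z ∈ xs → z ∈ x ∷ reached ⊎ z ∈ filter (λ z → ¬? (z ≟ x)) rest
      cover′ {z} z∈ with cover z∈ | z ≟ x
      ... | inj₁ p | _ = inj₁ (there p)
      ... | inj₂ _ | yes refl = inj₁ (here refl)
      ... | inj₂ p | no z≢x = inj₂ (∈-filter⁺ (λ z → ¬? (z ≟ x)) p z≢x)

  hall : {R : E → E → Set} → Decidable R → (xs ys : List E) → Matching R xs ys ⊎ Violator R xs ys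
  hall R? [] ys = inj₁ (record { match = λ x → x ; match-∈ = λ () ; match-R = λ () ; injective = λ () })
  hall {R} R? (x₀ ∷ xs) ys with hall R? xs ys
  ... | inj₂ V = inj₂ (record { Violator V ; deficit∈ = there (Violator.deficit∈ V) ; matched⊆ = there ∘ Violator.matched⊆ V })
  ... | inj₁ M with x₀ ∈? xs
  ... | no x₀∉xs = search (length xs) [] xs ≤-refl (λ ()) [] inj₂ (λ { (here refl) → reroot-here })
    where open Augment R? M x₀∉xs
  -- A repeated element needs no partner of its own, since injectivity compares elements and not
  -- positions.
  ... | yes x₀∈xs = inj₁ (record
    { match = match ; match-∈ = match-∈ ∘ in-xs ; match-R = match-R ∘ in-xs
    ; injective = λ p q → injective (in-xs p) (in-xs q) })
    where
    open Matching M
    in-xs : ∀ {x} → x ∈ x₀ ∷ xs → x ∈ xs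
    in-xs (here refl) = x₀∈xs
    in-xs (there p) = p

-- Ranked posets with the diamond property, and duality.

-- Isolates the self-dual properties of the Boolean lattice that the argument needs,
-- so that the part below A is the part above A in the dual.
record DiamondPoset : Set₁ where
  infix 4 _⋖_ _⋖?_ _≼_ _≼?_ _≟_
  field
    E          : Set
    _≟_        : DecidableEquality E
    elements   : List E
    complete   : ∀ x → x ∈ elements
    unique     : Unique elements
    _≼_        : E → E → Set
    _≼?_       : Decidable _≼_
    ≼-refl     : ∀ {x} → x ≼ x
    ≼-trans    : ∀ {x y z} → x ≼ y → y ≼ z → x ≼ z
    ≼-antisym  : ∀ {x y} → x ≼ y → y ≼ x → x ≡ y
    _⋖_        : E → E → Set
    _⋖?_       : Decidable _⋖_
    ⋖⇒≼        : ∀ {x y} → x ⋖ y → x ≼ y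
    coverBelow : ∀ {x y} → x ≼ y → x ≢ y → ∃ λ z → x ≼ z × z ⋖ y
    coverAbove : ∀ {x y} → x ≼ y → x ≢ y → ∃ λ z → x ⋖ z × z ≼ y
    rank       : E → ℕ
    rank-⋖     : ∀ {x y} → x ⋖ y → rank y ≡ suc (rank x)
    corank     : E → ℕ
    corank-⋖   : ∀ {x y} → x ⋖ y → corank x ≡ suc (corank y)
    other      : E → E → E → E
    other-⋗    : ∀ {w v t} → w ⋖ v → v ⋖ t → w ⋖ other w v t
    other-⋖    : ∀ {w v t} → w ⋖ v → v ⋖ t → other w v t ⋖ t
    other-≢    : ∀ {w v t} → w ⋖ v → v ⋖ t → other w v t ≢ v
    meet-unique : ∀ {w w′ v v′} → v ≢ v′ → w ⋖ v → w ⋖ v′ → w′ ⋖ v → w′ ⋖ v′ → w ≡ w′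
    join-unique : ∀ {v v′ t t′} → v ≢ v′ → v ⋖ t → v′ ⋖ t → v ⋖ t′ → v′ ⋖ t′ → t ≡ t′

dual : DiamondPoset → DiamondPoset
dual D = record
  { E = E ; _≟_ = _≟_ ; elements = elements ; complete = complete ; unique = unique
  ; _≼_ = flip _≼_ ; _≼?_ = flip _≼?_
  ; ≼-refl = ≼-refl ; ≼-trans = flip ≼-trans ; ≼-antisym = flip ≼-antisym
  ; _⋖_ = flip _⋖_ ; _⋖?_ = flip _⋖?_ ; ⋖⇒≼ = ⋖⇒≼
  ; coverBelow = λ p q → let z , r , s = coverAbove p (q ∘ sym) in z , s , r
  ; coverAbove = λ p q → let z , r , s = coverBelow p (q ∘ sym) in z , s , r
  ; rank = corank ; rank-⋖ = corank-⋖ ; corank = rank ; corank-⋖ = rank-⋖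
  ; other = λ w v t → other t v w
  ; other-⋗ = flip other-⋖ ; other-⋖ = flip other-⋗ ; other-≢ = flip other-≢
  ; meet-unique = join-unique ; join-unique = meet-unique }
  where open DiamondPoset D

-- Propagating an upward matching one level down.

module Propagation (D : DiamondPoset) where
  open DiamondPoset D
  open Finite _≟_

  -- Let y range over the matched elements of a Hall violator. A pair w ⋖ v is sent
  -- first to other w v (μ v), which is match y for some y, and then to the pair
  -- y ⋖ other y (match y) (μ v). This is injective, but misses the deficit.
  propagate : ∀ {W V T} → Unique V →
              (∀ {w} → w ∈ W → ∃ λ v → v ∈ V × w ⋖ v) →
              (∀ {w v t} → w ∈ W → t ∈ T → w ⋖ v → v ⋖ t → v ∈ V) →
              Matching _⋖_ V T → Matching _⋖_ W V
  propagate {W} {V} {T} uniqueV above between μ with hall _⋖?_ W V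
  ... | inj₁ ν = ν
  ... | inj₂ violator = ⊥-elim (<-irrefl refl
      (length-≤-of-injective-relation Next ((deficit , v₀) ∷ pairs) pairs uniquePairs total inj))
    where
    open Violator violator renaming (unique to uniqueMatched)
    open Matching μ renaming (match to up; match-∈ to up-∈; match-R to ⋖up; injective to up-inj)
    open Matching matching

    v₀ : E
    v₀ = proj₁ (above deficit∈)

    isPair : (p : E × E) → Dec (proj₁ p ⋖ proj₂ p)
    isPair (w , v) = w ⋖? v

    pairs : List (E × E)
    pairs = filter isPair (cartesianProduct matched V)

    uniquePairs : Unique ((deficit , v₀) ∷ pairs)
    uniquePairs =
      ∉⇒All≢ (λ p → Unique.Unique[x∷xs]⇒x∉xs uniqueMatched
                (proj₁ (∈-cartesianProduct⁻ matched V (proj₁ (∈-filter⁻ isPair p)))))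
      ∷ Unique.filter⁺ isPair (Unique.cartesianProduct⁺ (AllPairs.tail uniqueMatched) uniqueV)

    data Next : E × E → E × E → Set where
      next : ∀ {w v y v″} → w ⋖ v → w ⋖ match y → v ≢ match y → match y ⋖ up v →
             v″ ⋖ up v → match y ≢ v″ → Next (w , v) (y , v″)

    isNeighbour : ∀ {w v} → (w , v) ∈ (deficit , v₀) ∷ pairs → w ∈ deficit ∷ matched × v ∈ V × w ⋖ v
    isNeighbour (here refl) = here refl , proj₂ (above deficit∈)
    isNeighbour (there p) with q , w⋖v ← ∈-filter⁻ isPair p
      with w∈ , v∈ ← ∈-cartesianProduct⁻ matched V q = there w∈ , v∈ , w⋖v

    in-W : ∀ {w} → w ∈ deficit ∷ matched → w ∈ W
    in-W (here refl) = deficit∈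
    in-W (there p) = matched⊆ p

    total : ∀ {p} → p ∈ (deficit , v₀) ∷ pairs → ∃ λ q → q ∈ pairs × Next p q
    total {w , v} p∈
      with w∈ , v∈ , w⋖v ← isNeighbour p∈
      with v⋖t ← ⋖up v∈
      -- The other middle element of the diamond is again in `V`, so saturation makes it a partner
      -- of some `y` in `matched`.
      with v′∈ ← between (in-W w∈) (up-∈ v∈) (other-⋗ w⋖v v⋖t) (other-⋖ w⋖v v⋖t)
      with y , y∈ , v′≡my ← ∈-map⁻ match (saturated w∈ v′∈ (other-⋗ w⋖v v⋖t)) =
      (y , other y (match y) (up v)) ,
      ∈-filter⁺ isPair (∈-cartesianProduct⁺ y∈ v″∈) (other-⋗ y⋖ my⋖t) ,
      next w⋖v (subst (w ⋖_) v′≡my (other-⋗ w⋖v v⋖t))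
           (λ eq → other-≢ w⋖v v⋖t (trans v′≡my (sym eq)))
           my⋖t (other-⋖ y⋖ my⋖t) (λ eq → other-≢ y⋖ my⋖t (sym eq))
      where
      y⋖ = match-R y∈
      my⋖t = subst (_⋖ up v) v′≡my (other-⋖ w⋖v v⋖t)
      v″∈ = between (matched⊆ y∈) (up-∈ v∈) (other-⋗ y⋖ my⋖t) (other-⋖ y⋖ my⋖t)

    -- The target `(y , v″)` determines the source: `up v` is the only common upper cover of
    -- `match y` and `v″`, which gives `v` since `up` is injective; then `w` is the only common
    -- lower cover of `v` and `match y`.
    inj : ∀ {p p′ q} → p ∈ (deficit , v₀) ∷ pairs → p′ ∈ (deficit , v₀) ∷ pairs →
          Next p q → Next p′ q → p ≡ p′
    inj p∈ p′∈ (next a b c d e f) (next a′ b′ c′ d′ e′ f′)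
      with refl ← up-inj (proj₁ (proj₂ (isNeighbour p∈))) (proj₁ (proj₂ (isNeighbour p′∈)))
                         (join-unique f d e d′ e′)
      with refl ← meet-unique c a b a′ b′ = refl

-- Convex sets with a maximum antichain, and half-chains.

module _ (D : DiamondPoset) where
  open DiamondPoset D

  record ConvexWithMaximumAntichain : Set₁ where
    field
      C         : E → Set
      C?        : ∀ x → Dec (C x)
      convex    : ∀ {x y z} → C x → C y → x ≼ z → z ≼ y → C z
      A         : List E
      uniqueA   : Unique A
      A⊆C       : ∀ {a} → a ∈ A → C a
      antichain : ∀ {a b} → a ∈ A → b ∈ A → a ≼ b → a ≡ b
      maximum   : ∀ B → Unique B → (∀ {b} → b ∈ B → C b) →
                  (∀ {a b} → a ∈ B → b ∈ B → a ≼ b → a ≡ b) → length B ≤ length A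

  -- `ascending a` is the part of the chain through `a` strictly above `a`. In the dual poset the
  -- same record describes the part strictly below.
  record Ascents (C : E → Set) (A : List E) : Set where
    field
      ascending : E → List E
      linked    : ∀ a → Linked _⋖_ (a ∷ ascending a)
      sound     : ∀ a {x} → x ∈ ascending a → (C x × Any (_≼ x) A) × x ∉ A
      covers    : ∀ {x} → C x → Any (_≼ x) A → x ∉ A → ∃ λ a → a ∈ A × x ∈ ascending a
      disjoint  : ∀ {x a b} → a ∈ A → b ∈ A → x ∈ ascending a → x ∈ ascending b → a ≡ b

dualConfiguration : ∀ {D} → ConvexWithMaximumAntichain D → ConvexWithMaximumAntichain (dual D)
dualConfiguration K = record
  { C = C ; C? = C? ; convex = λ p q r s → convex q p s r
  ; A = A ; uniqueA = uniqueA ; A⊆C = A⊆C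
  ; antichain = λ p q r → sym (antichain q p r)
  ; maximum = λ B u B⊆C anti → maximum B u B⊆C λ p q r → sym (anti q p r) }
  where open ConvexWithMaximumAntichain K

-- The part of the convex set above the antichain.

module Above (D : DiamondPoset) (K : ConvexWithMaximumAntichain D) where

  open DiamondPoset D
  open ConvexWithMaximumAntichain K
  open Finite _≟_
  open DecMembership _≟_ using (_∈?_)
  open Propagation D

  -- Descend from `y` one cover at a time. The number `k` stands for the rank of `y` to make the
  -- recursion structural; later inductions on rank use the same device.
  ≼⇒≡⊎rank< : ∀ k {x y} → rank y ≡ k → x ≼ y → x ≡ y ⊎ rank x < rank y
  ≼⇒≡⊎rank< k {x} {y} eq x≼y with x ≟ y
  ... | yes x≡y = inj₁ x≡y
  ≼⇒≡⊎rank< k eq x≼y | no x≢y with z , x≼z , z⋖y ← coverBelow x≼y x≢y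
    with k | trans (sym (rank-⋖ z⋖y)) eq
  ... | suc k | eq′ with ≼⇒≡⊎rank< k (suc-injective eq′) x≼z
  ... | inj₁ refl = inj₂ (≤-reflexive (sym (rank-⋖ z⋖y)))
  ... | inj₂ lt = inj₂ (<-trans lt (≤-reflexive (sym (rank-⋖ z⋖y))))

  ≼-same-rank : ∀ {x y} → rank x ≡ rank y → x ≼ y → x ≡ y
  ≼-same-rank {x} {y} eq x≼y with ≼⇒≡⊎rank< (rank y) refl x≼y
  ... | inj₁ p = p
  ... | inj₂ lt = ⊥-elim (<⇒≢ lt eq)

  P : E → Set
  P x = C x × Any (_≼ x) A

  P? : ∀ x → Dec (P x)
  P? x = C? x ×-dec any? (_≼? x) A

  P-between : ∀ {x y z} → P x → P y → x ≼ z → z ≼ y → P z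
  P-between (Cx , a≼x) (Cy , _) x≼z z≼y with a , a∈ , p ← find a≼x =
    convex Cx Cy x≼z z≼y , lose a∈ (≼-trans p x≼z)

  A⇒P : ∀ {a} → a ∈ A → P a
  A⇒P a∈ = A⊆C a∈ , lose a∈ ≼-refl

  P≼A : ∀ {x a} → P x → a ∈ A → x ≼ a → x ≡ a
  P≼A (_ , q) a∈ x≼a with b , b∈ , b≼x ← find q
    with refl ← antichain b∈ a∈ (≼-trans b≼x x≼a) = ≼-antisym x≼a b≼x

  Proper : E → Set
  Proper x = P x × x ∉ A

  proper? : ∀ x → Dec (Proper x)
  proper? x = P? x ×-dec ¬? (x ∈? A)

  proper P-elements : List E
  proper = filter proper? elements
  P-elements = filter P? elements

  -- A Hall violator yields a larger antichain.

  module NoViolator (violator : Violator (flip _⋖_) proper P-elements) where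
    open Violator violator renaming (deficit to t₀; unique to uniqueMatched)
    open Matching matching

    -- Keeping a single rank makes `T` an antichain. Saturation survives, because all upper covers
    -- of an element have the same rank.
    Y : List E
    Y = filter (λ y → rank y ≟ℕ rank t₀) matched

    T : List E
    T = t₀ ∷ Y

    T⊆ : ∀ {t} → t ∈ T → t ∈ t₀ ∷ matched
    T⊆ (here p) = here p
    T⊆ (there p) = there (proj₁ (∈-filter⁻ (λ y → rank y ≟ℕ rank t₀) p))

    T-rank : ∀ {t} → t ∈ T → rank t ≡ rank t₀
    T-rank (here refl) = refl
    T-rank (there p) = proj₂ (∈-filter⁻ (λ y → rank y ≟ℕ rank t₀) {xs = matched} p)

    T-proper : ∀ {t} → t ∈ T → Proper t
    T-proper t∈ with T⊆ t∈
    ... | here refl = proj₂ (∈-filter⁻ proper? {xs = elements} deficit∈)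
    ... | there p = proj₂ (∈-filter⁻ proper? {xs = elements} (matched⊆ p))

    uniqueT : Unique T
    uniqueT = ∉⇒All≢ (λ p → Unique.Unique[x∷xs]⇒x∉xs uniqueMatched (proj₁ (∈-filter⁻ (λ y → rank y ≟ℕ rank t₀) p)))
              ∷ Unique.filter⁺ (λ y → rank y ≟ℕ rank t₀) (AllPairs.tail uniqueMatched)

    descend? : ∀ S q → Dec (P q × Any (q ⋖_) S)
    descend? S q = P? q ×-dec any? (q ⋖?_) S

    -- The iterated lower shadows of `T` inside `P`.
    Q : ℕ → List E
    Q zero = T
    Q (suc i) = filter (descend? (Q i)) elements

    Q-∈ : ∀ i {q v} → P q → q ⋖ v → v ∈ Q i → q ∈ Q (suc i)
    Q-∈ i {q} Pq q⋖v v∈ = ∈-filter⁺ (descend? (Q i)) (complete q) (Pq , lose v∈ q⋖v)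

    Q-above : ∀ i {q} → q ∈ Q (suc i) → ∃ λ v → v ∈ Q i × q ⋖ v
    Q-above i q∈ = find (proj₂ (proj₂ (∈-filter⁻ (descend? (Q i)) {xs = elements} q∈)))

    Q-P : ∀ i {q} → q ∈ Q i → P q
    Q-P zero q∈ = proj₁ (T-proper q∈)
    Q-P (suc i) q∈ = proj₁ (proj₂ (∈-filter⁻ (descend? (Q i)) {xs = elements} q∈))

    -- The violator's matching inverted: by saturation each `q` in the first shadow is `match y` for
    -- some `y` in `Y`, and `y` determines `q`. The values lie in `Y`, so `t₀` is missed.
    bottomMatching : Matching _⋖_ (Q 1) Y
    bottomMatching = record
      { match = proj₁ chosen
      ; match-∈ = proj₁ ∘ proj₂ chosen
      ; match-R = λ {q} q∈ → subst (_⋖ proj₁ chosen q) (sym (proj₂ (proj₂ chosen q∈)))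
          (match-R (proj₁ (∈-filter⁻ (λ y → rank y ≟ℕ rank t₀) (proj₁ (proj₂ chosen q∈)))))
      ; injective = λ q∈ q′∈ eq → trans (proj₂ (proj₂ chosen q∈))
          (trans (cong match eq) (sym (proj₂ (proj₂ chosen q′∈)))) }
      where
      partner : ∀ {q} → q ∈ Q 1 → ∃ λ y → y ∈ Y × q ≡ match y
      partner {q} q∈ with t , t∈ , q⋖t ← Q-above 0 q∈
        with y , y∈ , refl ← ∈-map⁻ match (saturated (T⊆ t∈) (∈-filter⁺ P? (complete q) (Q-P 1 q∈)) q⋖t) =
        y , ∈-filter⁺ (λ y → rank y ≟ℕ rank t₀) y∈
              (trans (rank-⋖ (match-R y∈)) (trans (sym (rank-⋖ q⋖t)) (T-rank t∈))) , refl

      chosen = choice (Q 1) partner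

    matchings : ∀ i → Matching _⋖_ (Q (suc i)) (Q i)
    matchings zero = record { Matching bottomMatching ; match-∈ = there ∘ Matching.match-∈ bottomMatching }
    matchings (suc i) = propagate (Unique.filter⁺ (descend? (Q i)) unique) (Q-above (suc i))
      -- Intermediate elements lie in `P` by convexity, hence in the next shadow.
      (λ w∈ t∈ w⋖v v⋖t → Q-∈ i (P-between (Q-P (2 + i) w∈) (Q-P i t∈) (⋖⇒≼ w⋖v) (⋖⇒≼ v⋖t)) v⋖t t∈)
      (matchings i)

    μ : ℕ → E → E
    μ i = Matching.match (matchings i)

    climb : ℕ → E → E
    climb zero q = q
    climb (suc i) q = climb i (μ i q)

    -- The first `d` steps of the climb from level `d + i`, ending at level `i`.
    lift : ℕ → ℕ → E → E
    lift zero i q = q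
    lift (suc d) i q = lift d i (μ (d + i) q)

    climb-lift : ∀ d i q → climb (d + i) q ≡ climb i (lift d i q)
    climb-lift zero i q = refl
    climb-lift (suc d) i q = climb-lift d i (μ (d + i) q)

    lift-∈ : ∀ d i {q} → q ∈ Q (d + i) → lift d i q ∈ Q i
    lift-∈ zero i q∈ = q∈
    lift-∈ (suc d) i q∈ = lift-∈ d i (Matching.match-∈ (matchings (d + i)) q∈)

    ≼-lift : ∀ d i {q} → q ∈ Q (d + i) → q ≼ lift d i q
    ≼-lift zero i q∈ = ≼-refl
    ≼-lift (suc d) i q∈ = ≼-trans (⋖⇒≼ (Matching.match-R (matchings (d + i)) q∈))
      (≼-lift d i (Matching.match-∈ (matchings (d + i)) q∈))

    climb-injective : ∀ i {q q′} → q ∈ Q i → q′ ∈ Q i → climb i q ≡ climb i q′ → q ≡ q′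
    climb-injective zero _ _ eq = eq
    climb-injective (suc i) q∈ q′∈ eq = injective′ q∈ q′∈ (climb-injective i (match-∈′ q∈) (match-∈′ q′∈) eq)
      where open Matching (matchings i) renaming (injective to injective′; match-∈ to match-∈′)

    climb-∈Y : ∀ i {q} → q ∈ Q (suc i) → climb (suc i) q ∈ Y
    climb-∈Y zero q∈ = Matching.match-∈ bottomMatching q∈
    climb-∈Y (suc i) q∈ = climb-∈Y i (Matching.match-∈ (matchings (suc i)) q∈)

    -- Lift `b` to the level of `a`. From there both climbs end alike, so by injectivity the lift of
    -- `b` is `a`; hence `b` is below `a`, and both are in the antichain.
    climb-meet : ∀ {i j a b} → i ≤ j → a ∈ A → b ∈ A → a ∈ Q i → b ∈ Q j →
                 climb i a ≡ climb j b → b ≡ a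
    climb-meet {i} {j} {a} {b} i≤j a∈ b∈ a∈Q b∈Q eq
      with d , refl ← m≤n⇒∃[o]m+o≡n i≤j
      rewrite +-comm i d =
      antichain b∈ a∈ (subst (b ≼_)
        (sym (climb-injective i a∈Q (lift-∈ d i b∈Q) (trans eq (climb-lift d i b))))
        (≼-lift d i b∈Q))

    -- Walk down from `q` along covers that stay above `a`. Convexity keeps the walk in `P`, so each
    -- step enters the next shadow.
    reach : ∀ k {a} i {q} → rank q ≡ k → a ∈ A → q ∈ Q i → a ≼ q → ∃ λ j → a ∈ Q j
    reach k {a} i {q} eq a∈ q∈ a≼q with a ≟ q
    ... | yes refl = i , q∈
    ... | no a≢q with z , a≼z , z⋖q ← coverBelow a≼q a≢q with k | trans (sym (rank-⋖ z⋖q)) eq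
    ... | suc k | eq′ = reach k (suc i) (suc-injective eq′) a∈
      (Q-∈ i (P-between (A⇒P a∈) (Q-P i q∈) a≼z (⋖⇒≼ z⋖q)) z⋖q q∈) a≼z

    below? : ∀ x → Dec (Any (x ≼_) T)
    below? x = any? (x ≼?_) T

    rest : List E
    rest = filter (¬? ∘ below?) A

    rest-∈ : ∀ {a} → a ∈ rest → a ∈ A × ¬ Any (a ≼_) T
    rest-∈ = ∈-filter⁻ (¬? ∘ below?)

    -- The elements of `A` below `T` are exchanged for `T`. Members of `T` share a rank, one of them
    -- below a member of `A` would equal it by `P≼A`, and nothing in `rest` is below `T`.
    larger-antichain : suc (length (Y ++ rest)) ≤ length A
    larger-antichain = maximum (T ++ rest)
      (Unique.++⁺ uniqueT (Unique.filter⁺ (¬? ∘ below?) uniqueA)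
        λ (t∈T , t∈rest) → proj₂ (rest-∈ t∈rest) (lose t∈T ≼-refl))
      in-C anti
      where
      in-C : ∀ {b} → b ∈ T ++ rest → C b
      in-C b∈ with ∈-++⁻ T b∈
      ... | inj₁ p = proj₁ (proj₁ (T-proper p))
      ... | inj₂ p = A⊆C (proj₁ (rest-∈ p))

      anti : ∀ {a b} → a ∈ T ++ rest → b ∈ T ++ rest → a ≼ b → a ≡ b
      anti a∈ b∈ a≼b with ∈-++⁻ T a∈ | ∈-++⁻ T b∈
      ... | inj₁ p | inj₁ q = ≼-same-rank (trans (T-rank p) (sym (T-rank q))) a≼b
      ... | inj₁ p | inj₂ q = P≼A (proj₁ (T-proper p)) (proj₁ (rest-∈ q)) a≼b
      ... | inj₂ p | inj₁ q = ⊥-elim (proj₂ (rest-∈ p) (lose q a≼b))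
      ... | inj₂ p | inj₂ q = antichain (proj₁ (rest-∈ p)) (proj₁ (rest-∈ q)) a≼b

    data Replace : E → E → Set where
      stay : ∀ {a} → ¬ Any (a ≼_) T → Replace a a
      move : ∀ i {a} → a ∈ Q (suc i) → Replace a (climb (suc i) a)

    ∣A∣≤ : length A ≤ length (Y ++ rest)
    ∣A∣≤ = length-≤-of-injective-relation Replace A (Y ++ rest) uniqueA total (λ p q r s → inj p q r s refl)
      where
      total : ∀ {a} → a ∈ A → ∃ λ b → b ∈ Y ++ rest × Replace a b
      total {a} a∈ with below? a
      ... | no a≰T = a , ∈-++⁺ʳ Y (∈-filter⁺ (¬? ∘ below?) a∈ a≰T) , stay a≰T
      ... | yes a≤T with t , t∈ , a≼t ← find a≤T with reach (rank t) 0 refl a∈ t∈ a≼t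
      -- `T` avoids `A`, so the level is positive and the climb ends in `Y`.
      ... | zero , a∈T = ⊥-elim (proj₂ (T-proper a∈T) a∈)
      ... | suc i , a∈Q = climb (suc i) a , ∈-++⁺ˡ (climb-∈Y i a∈Q) , move i a∈Q

      top≼T : ∀ i {a} → a ∈ Q (suc i) → Any (climb (suc i) a ≼_) T
      top≼T i a∈Q = lose (there (climb-∈Y i a∈Q)) ≼-refl

      -- The images are equated by a separate argument because `climb` in the index of `move` blocks
      -- unification. A climb ends in `T`, whereas an element that stays is below nothing in `T`.
      inj : ∀ {a a′ b b′} → a ∈ A → a′ ∈ A → Replace a b → Replace a′ b′ → b ≡ b′ → a ≡ a′
      inj a∈ a′∈ (stay _) (stay _) eq = eq
      inj a∈ a′∈ (stay n) (move i q) refl = ⊥-elim (n (top≼T i q))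
      inj a∈ a′∈ (move i q) (stay n) refl = ⊥-elim (n (top≼T i q))
      inj a∈ a′∈ (move i q) (move j q′) eq with ≤-total (suc i) (suc j)
      ... | inj₁ i≤j = sym (climb-meet i≤j a∈ a′∈ q q′ eq)
      ... | inj₂ j≤i = climb-meet j≤i a′∈ a∈ q′ q (sym eq)

    absurd : ⊥
    absurd = <-irrefl refl (≤-trans larger-antichain ∣A∣≤)

  -- Growing the half-chains from the matching.

  downMatching : Matching (flip _⋖_) proper P-elements
  downMatching with hall (flip _⋖?_) proper P-elements
  ... | inj₁ M = M
  ... | inj₂ violator = ⊥-elim (NoViolator.absurd violator)

  open Matching downMatching using () renaming (match to φ)

  proper-∈ : ∀ {x} → Proper x → x ∈ proper
  proper-∈ {x} = ∈-filter⁺ proper? (complete x)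

  φ-⋖ : ∀ {x} → Proper x → φ x ⋖ x
  φ-⋖ p = Matching.match-R downMatching (proper-∈ p)

  φ-P : ∀ {x} → Proper x → P (φ x)
  φ-P p = proj₂ (∈-filter⁻ P? {xs = elements} (Matching.match-∈ downMatching (proper-∈ p)))

  φ-injective : ∀ {x y} → Proper x → Proper y → φ x ≡ φ y → x ≡ y
  φ-injective p q = Matching.injective downMatching (proper-∈ p) (proper-∈ q)

  Next : E → E → Set
  Next x y = Proper y × φ y ≡ x

  next? : ∀ x y → Dec (Next x y)
  next? x y = proper? y ×-dec (φ y ≟ x)

  -- Follows `φ` backwards; on proper elements `φ` is injective, so the successor is unique. The
  -- number is fuel, and `corank x` suffices because corank drops by one at each cover.
  ascend : ℕ → E → List E
  ascend zero x = []
  ascend (suc k) x with any? (next? x) elements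
  ... | yes p = proj₁ (find p) ∷ ascend k (proj₁ (find p))
  ... | no _ = []

  ascending : E → List E
  ascending a = ascend (corank a) a

  ascend-linked : ∀ k x → Linked _⋖_ (x ∷ ascend k x)
  ascend-linked zero x = [-]
  ascend-linked (suc k) x with any? (next? x) elements
  ... | no _ = [-]
  ... | yes p with y , _ , Py , refl ← find p = φ-⋖ Py ∷ ascend-linked k y

  ascend-∈ : ∀ k {x y} → y ∈ ascend k x → Proper y × φ y ∈ x ∷ ascend k x
  ascend-∈ (suc k) {x} y∈ with any? (next? x) elements
  ... | yes p with z , _ , Pz , φz≡x ← find p with y∈
  ...   | here refl = Pz , here φz≡x
  ...   | there q = let Py , φy∈ = ascend-∈ k q in Py , there φy∈

  -- With fuel equal to corank, the list can run out of fuel only where nothing covers the current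
  -- element. The successor found at `φ y` has the same image under `φ` as `y`, hence is `y`.
  ascend-extend : ∀ k {x y} → corank x ≡ k → Proper y → φ y ∈ x ∷ ascend k x → y ∈ ascend k x
  ascend-extend zero eq Py (here refl) with () ← trans (sym (corank-⋖ (φ-⋖ Py))) eq
  ascend-extend (suc k) {x} {y} eq Py φy∈ with any? (next? x) elements
  ascend-extend (suc k) {x} {y} eq Py (here φy≡x) | no stuck = ⊥-elim (stuck (lose (complete y) (Py , φy≡x)))
  ... | yes p with z , _ , Pz , refl ← find p with φy∈
  ... | here φy≡φz = here (φ-injective Py Pz φy≡φz)
  ... | there q = there (ascend-extend k (suc-injective (trans (sym (corank-⋖ (φ-⋖ Pz))) eq)) Py q)

  -- Descend from `x` along `φ` until `A` is met.
  ascending-covers : ∀ k {x} → rank x ≡ k → Proper x → ∃ λ a → a ∈ A × x ∈ ascending a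
  ascending-covers k {x} eq Px with φ x ∈? A
  ... | yes φx∈A = φ x , φx∈A , ascend-extend _ refl Px (here refl)
  ... | no φx∉A with k | trans (sym (rank-⋖ (φ-⋖ Px))) eq
  ... | suc k | eq′ with a , a∈ , φx∈ ← ascending-covers k (suc-injective eq′) (φ-P Px , φx∉A) =
    a , a∈ , ascend-extend _ refl Px (there φx∈)

  -- Descend along `φ` in both lists at once. If one descent ends first, its endpoint is in `A` but
  -- also in the other list, whose members avoid `A`.
  ascending-disjoint : ∀ k {x a b} → rank x ≡ k → a ∈ A → b ∈ A →
                       x ∈ ascending a → x ∈ ascending b → a ≡ b
  ascending-disjoint k {x} {a} {b} eq a∈ b∈ x∈a x∈b
    with Px , φx∈a ← ascend-∈ (corank a) x∈a
    with _ , φx∈b ← ascend-∈ (corank b) x∈b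
    with φx∈a | φx∈b
  ... | here p | here q = trans (sym p) q
  ... | here refl | there q = ⊥-elim (proj₂ (proj₁ (ascend-∈ (corank b) q)) a∈)
  ... | there p | here refl = ⊥-elim (proj₂ (proj₁ (ascend-∈ (corank a) p)) b∈)
  ... | there p | there q with k | trans (sym (rank-⋖ (φ-⋖ Px))) eq
  ... | suc k | eq′ = ascending-disjoint k (suc-injective eq′) a∈ b∈ p q

  ascents : Ascents D C A
  ascents = record
    { ascending = ascending
    ; linked    = λ a → ascend-linked (corank a) a
    ; sound     = λ a x∈ → proj₁ (ascend-∈ (corank a) x∈)
    ; covers    = λ Cx a≼x x∉A → ascending-covers _ refl ((Cx , a≼x) , x∉A)
    ; disjoint  = ascending-disjoint _ refl }

-- The Boolean lattice as a `DiamondPoset`.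

infix 4 _⋖ˢ_ _⋖ˢ?_

data _⋖ˢ_ : ∀ {n} → Subset n → Subset n → Set where
  here  : ∀ {n} {x : Subset n} → outside ∷ x ⋖ˢ inside ∷ x
  there : ∀ {n s} {x y : Subset n} → x ⋖ˢ y → s ∷ x ⋖ˢ s ∷ y

there-⋖ˢ : ∀ {n s} {x y : Subset n} → s ∷ x ⋖ˢ s ∷ y → x ⋖ˢ y
there-⋖ˢ (there p) = p

_≟ˢ_ : ∀ {n} → DecidableEquality (Subset n)
_≟ˢ_ = ≡-dec Bool._≟_

_⋖ˢ?_ : ∀ {n} → Decidable (_⋖ˢ_ {n})
[] ⋖ˢ? [] = no λ ()
(false ∷ x) ⋖ˢ? (false ∷ y) = map′ there there-⋖ˢ (x ⋖ˢ? y)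
(true ∷ x) ⋖ˢ? (true ∷ y) = map′ there there-⋖ˢ (x ⋖ˢ? y)
(false ∷ x) ⋖ˢ? (true ∷ y) = map′ (λ { refl → here }) (λ { here → refl }) (x ≟ˢ y)
(true ∷ x) ⋖ˢ? (false ∷ y) = no λ ()

⋖ˢ⇒⊆ : ∀ {n} {x y : Subset n} → x ⋖ˢ y → x ⊆ y
⋖ˢ⇒⊆ here = out⊆ ⊆-refl
⋖ˢ⇒⊆ (there p) = s⊆s (⋖ˢ⇒⊆ p)

∣∣-⋖ˢ : ∀ {n} {x y : Subset n} → x ⋖ˢ y → ∣ y ∣ ≡ suc ∣ x ∣
∣∣-⋖ˢ here = refl
∣∣-⋖ˢ (there {s = false} p) = ∣∣-⋖ˢ p
∣∣-⋖ˢ (there {s = true} p) = cong suc (∣∣-⋖ˢ p)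

∣∁∣-⋖ˢ : ∀ {n} {x y : Subset n} → x ⋖ˢ y → ∣ ∁ x ∣ ≡ suc ∣ ∁ y ∣
∣∁∣-⋖ˢ here = refl
∣∁∣-⋖ˢ (there {s = false} p) = cong suc (∣∁∣-⋖ˢ p)
∣∁∣-⋖ˢ (there {s = true} p) = ∣∁∣-⋖ˢ p

-- Remove from `y` the first element that `x` lacks; `coverAboveˢ` adds this element to `x`.
coverBelowˢ : ∀ {n} {x y : Subset n} → x ⊆ y → x ≢ y → ∃ λ z → x ⊆ z × z ⋖ˢ y
coverBelowˢ {x = []} {[]} x⊆y x≢y = ⊥-elim (x≢y refl)
coverBelowˢ {x = true ∷ x} {false ∷ y} x⊆y x≢y with () ← x⊆y here
coverBelowˢ {x = false ∷ x} {true ∷ y} x⊆y x≢y = false ∷ y , s⊆s (drop-∷-⊆ x⊆y) , here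
coverBelowˢ {x = false ∷ x} {false ∷ y} x⊆y x≢y
  with z , x⊆z , z⋖y ← coverBelowˢ (drop-∷-⊆ x⊆y) (x≢y ∘ cong (false ∷_)) = false ∷ z , s⊆s x⊆z , there z⋖y
coverBelowˢ {x = true ∷ x} {true ∷ y} x⊆y x≢y
  with z , x⊆z , z⋖y ← coverBelowˢ (drop-∷-⊆ x⊆y) (x≢y ∘ cong (true ∷_)) = true ∷ z , s⊆s x⊆z , there z⋖y

coverAboveˢ : ∀ {n} {x y : Subset n} → x ⊆ y → x ≢ y → ∃ λ z → x ⋖ˢ z × z ⊆ y
coverAboveˢ {x = []} {[]} x⊆y x≢y = ⊥-elim (x≢y refl)
coverAboveˢ {x = true ∷ x} {false ∷ y} x⊆y x≢y with () ← x⊆y here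
coverAboveˢ {x = false ∷ x} {true ∷ y} x⊆y x≢y = true ∷ x , here , s⊆s (drop-∷-⊆ x⊆y)
coverAboveˢ {x = false ∷ x} {false ∷ y} x⊆y x≢y
  with z , x⋖z , z⊆y ← coverAboveˢ (drop-∷-⊆ x⊆y) (x≢y ∘ cong (false ∷_)) = false ∷ z , there x⋖z , s⊆s z⊆y
coverAboveˢ {x = true ∷ x} {true ∷ y} x⊆y x≢y
  with z , x⋖z , z⊆y ← coverAboveˢ (drop-∷-⊆ x⊆y) (x≢y ∘ cong (true ∷_)) = true ∷ z , there x⋖z , s⊆s z⊆y

-- In a diamond this is `w` with the one element by which `t` exceeds `v`.
otherˢ : ∀ {n} → Subset n → Subset n → Subset n → Subset n
otherˢ w v t = w ∪ (t ∩ ∁ v)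

otherˢ-idem : ∀ {n} (x : Subset n) → otherˢ x x x ≡ x
otherˢ-idem [] = refl
otherˢ-idem (false ∷ x) = cong (false ∷_) (otherˢ-idem x)
otherˢ-idem (true ∷ x) = cong (true ∷_) (otherˢ-idem x)

otherˢ-lower : ∀ {n} {x y : Subset n} → x ⋖ˢ y → otherˢ x x y ≡ y
otherˢ-lower {x = _ ∷ x} here = cong (true ∷_) (otherˢ-idem x)
otherˢ-lower (there {s = false} p) = cong (false ∷_) (otherˢ-lower p)
otherˢ-lower (there {s = true} p) = cong (true ∷_) (otherˢ-lower p)

otherˢ-upper : ∀ {n} {x y : Subset n} → x ⋖ˢ y → otherˢ x y y ≡ x
otherˢ-upper {x = _ ∷ x} here = cong (false ∷_) (otherˢ-idem x)
otherˢ-upper (there {s = false} p) = cong (false ∷_) (otherˢ-upper p)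
otherˢ-upper (there {s = true} p) = cong (true ∷_) (otherˢ-upper p)

otherˢ-diamond : ∀ {n} {w v t : Subset n} → w ⋖ˢ v → v ⋖ˢ t →
                 w ⋖ˢ otherˢ w v t × otherˢ w v t ⋖ˢ t × otherˢ w v t ≢ v
-- When one cover changes the head, the tail of the fourth element is an end of the other cover.
otherˢ-diamond here (there q) rewrite otherˢ-lower q = there q , here , λ ()
otherˢ-diamond (there p) here rewrite otherˢ-upper p = here , there p , λ ()
otherˢ-diamond (there {s = false} p) (there q) with a , b , c ← otherˢ-diamond p q =
  there a , there b , c ∘ ∷-injectiveʳ
otherˢ-diamond (there {s = true} p) (there q) with a , b , c ← otherˢ-diamond p q =
  there a , there b , c ∘ ∷-injectiveʳ

-- The common lower cover is forced to be the intersection. Compare the positions at which the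
-- covers are made: two made at the head of the same set would give `v ≡ v′`.
meet-uniqueˢ : ∀ {n} {w w′ v v′ : Subset n} → v ≢ v′ → w ⋖ˢ v → w ⋖ˢ v′ → w′ ⋖ˢ v → w′ ⋖ˢ v′ → w ≡ w′
meet-uniqueˢ v≢v′ here here _ _ = ⊥-elim (v≢v′ refl)
meet-uniqueˢ v≢v′ _ _ here here = ⊥-elim (v≢v′ refl)
meet-uniqueˢ v≢v′ here (there p) here (there q) = refl
meet-uniqueˢ v≢v′ (there p) here (there q) here = refl
meet-uniqueˢ v≢v′ (there p) (there q) (there p′) (there q′) =
  cong (_ ∷_) (meet-uniqueˢ (v≢v′ ∘ cong (_ ∷_)) p q p′ q′)

join-uniqueˢ : ∀ {n} {v v′ t t′ : Subset n} → v ≢ v′ → v ⋖ˢ t → v′ ⋖ˢ t → v ⋖ˢ t′ → v′ ⋖ˢ t′ → t ≡ t′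
join-uniqueˢ v≢v′ here here _ _ = ⊥-elim (v≢v′ refl)
join-uniqueˢ v≢v′ _ _ here here = ⊥-elim (v≢v′ refl)
join-uniqueˢ v≢v′ here (there p) here (there q) = refl
join-uniqueˢ v≢v′ (there p) here (there q) here = refl
join-uniqueˢ v≢v′ (there p) (there q) (there p′) (there q′) =
  cong (_ ∷_) (join-uniqueˢ (v≢v′ ∘ cong (_ ∷_)) p q p′ q′)

subsets : ∀ n → List (Subset n)
subsets zero = [] ∷ []
subsets (suc n) = map (false ∷_) (subsets n) ++ map (true ∷_) (subsets n)

subsets-complete : ∀ {n} (x : Subset n) → x ∈ subsets n
subsets-complete [] = here refl
subsets-complete (false ∷ x) = ∈-++⁺ˡ (∈-map⁺ _ (subsets-complete x))
subsets-complete (true ∷ x) = ∈-++⁺ʳ _ (∈-map⁺ _ (subsets-complete x))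

subsets-unique : ∀ n → Unique (subsets n)
subsets-unique zero = [] ∷ []
subsets-unique (suc n) = Unique.++⁺ (Unique.map⁺ ∷-injectiveʳ (subsets-unique n))
  (Unique.map⁺ ∷-injectiveʳ (subsets-unique n)) disjoint
  where
  disjoint : ∀ {x} → ¬ (x ∈ map (false ∷_) (subsets n) × x ∈ map (true ∷_) (subsets n))
  disjoint (p , q) with _ , _ , refl ← ∈-map⁻ (false ∷_) p with ∈-map⁻ (true ∷_) q
  ... | _ , _ , ()

boolean : ℕ → DiamondPoset
boolean n = record
  { E = Subset n ; _≟_ = _≟ˢ_
  ; elements = subsets n ; complete = subsets-complete ; unique = subsets-unique n
  ; _≼_ = _⊆_ ; _≼?_ = _⊆?_
  ; ≼-refl = ⊆-refl ; ≼-trans = ⊆-trans ; ≼-antisym = ⊆-antisym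
  ; _⋖_ = _⋖ˢ_ ; _⋖?_ = _⋖ˢ?_ ; ⋖⇒≼ = ⋖ˢ⇒⊆
  ; coverBelow = coverBelowˢ ; coverAbove = coverAboveˢ
  ; rank = ∣_∣ ; rank-⋖ = ∣∣-⋖ˢ ; corank = ∣_∣ ∘ ∁ ; corank-⋖ = ∣∁∣-⋖ˢ
  ; other = otherˢ
  ; other-⋗ = λ p q → proj₁ (otherˢ-diamond p q)
  ; other-⋖ = λ p q → proj₁ (proj₂ (otherˢ-diamond p q))
  ; other-≢ = λ p q → proj₂ (proj₂ (otherˢ-diamond p q))
  ; meet-unique = meet-uniqueˢ ; join-unique = join-uniqueˢ }

-- Joining the half-chains into a partition.

join-linked : {A : Set} {R : A → A → Set} {x : A} (ds us : List A) →
              Linked (flip R) (x ∷ ds) → Linked R (x ∷ us) → Linked R (ds ʳ++ (x ∷ us))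
join-linked [] us _ up = up
join-linked (d ∷ ds) us (d-x ∷ down) up = join-linked ds (_ ∷ us) down (d-x ∷ up)

∈-ʳ++⁻ : {A : Set} {x : A} (ds : List A) {us : List A} → x ∈ ds ʳ++ us → x ∈ ds ⊎ x ∈ us
∈-ʳ++⁻ [] p = inj₂ p
∈-ʳ++⁻ (d ∷ ds) p with ∈-ʳ++⁻ ds p
... | inj₁ q = inj₁ (there q)
... | inj₂ (here q) = inj₁ (here q)
... | inj₂ (there q) = inj₂ q

∈-ʳ++⁺ʳ : {A : Set} {x : A} (ds : List A) {us : List A} → x ∈ us → x ∈ ds ʳ++ us
∈-ʳ++⁺ʳ [] p = p
∈-ʳ++⁺ʳ (d ∷ ds) p = ∈-ʳ++⁺ʳ ds (there p)

∈-ʳ++⁺ˡ : {A : Set} {x : A} (ds : List A) {us : List A} → x ∈ ds → x ∈ ds ʳ++ us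
∈-ʳ++⁺ˡ (d ∷ ds) (here p) = ∈-ʳ++⁺ʳ ds (here p)
∈-ʳ++⁺ˡ (d ∷ ds) (there p) = ∈-ʳ++⁺ˡ ds p

-- The membership argument only excludes the empty list, which `Skipless` does not admit.
linked-skipless : ∀ {n} {x : Subset n} {xs} → x ∈ xs → Linked _⋖ˢ_ xs → Skipless xs
linked-skipless _ [-] = single _
linked-skipless _ (p ∷ l) = cons _ _ _ (⋖ˢ⇒⊆ p) (∣∣-⋖ˢ p) (linked-skipless (here refl) l)

linked-unique : ∀ {n} {xs : List (Subset n)} → Linked _⋖ˢ_ xs → Unique xs
linked-unique l = AllPairs.map (λ lt eq → <⇒≢ lt (cong ∣_∣ eq))
  (Linked⇒AllPairs (λ {x} {y} {z} → <-trans {∣ x ∣} {∣ y ∣} {∣ z ∣})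
    (Linked.map (λ p → ≤-reflexive (sym (∣∣-⋖ˢ p))) l))

unique-map⇒disjoint : {A B : Set} (f : A → List B) {xs : List A} → Unique xs →
                      (∀ {a b x} → a ∈ xs → b ∈ xs → x ∈ f a → x ∈ f b → a ≡ b) →
                      AllPairs Disjoint (map f xs)
unique-map⇒disjoint f [] _ = []
unique-map⇒disjoint f {x ∷ xs} (x∉ ∷ u) h =
  All.tabulate head ∷ unique-map⇒disjoint f u (λ p q → h (there p) (there q))
  where
  head : ∀ {ys} → ys ∈ map f xs → Disjoint (f x) ys
  head ys∈ (p , q) with z , z∈ , refl ← ∈-map⁻ f ys∈ =
    All.lookup x∉ z∈ (h (here refl) (there z∈) p q)

module Assemble {n : ℕ} (K : ConvexWithMaximumAntichain (boolean n)) where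

  open ConvexWithMaximumAntichain K

  up : Ascents (boolean n) C A
  up = Above.ascents (boolean n) K

  down : Ascents (dual (boolean n)) C A
  down = Above.ascents (dual (boolean n)) (dualConfiguration K)

  module Up = Ascents up
  module Down = Ascents down

  -- `Down.ascending a` runs downwards from `a`, so it is reversed onto the upper half.
  chain : Subset n → List (Subset n)
  chain a = Down.ascending a ʳ++ (a ∷ Up.ascending a)

  chain-linked : ∀ a → Linked _⋖ˢ_ (chain a)
  chain-linked a = join-linked (Down.ascending a) (Up.ascending a) (Down.linked a) (Up.linked a)

  ∈-chain : ∀ a → a ∈ chain a
  ∈-chain a = ∈-ʳ++⁺ʳ (Down.ascending a) (here refl)

  skipless : ∀ {xs} → xs ∈ map chain A → Skipless xs
  skipless xs∈ with a , _ , refl ← ∈-map⁻ chain xs∈ = linked-skipless (∈-chain a) (chain-linked a)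

  unique-chain : ∀ {xs} → xs ∈ map chain A → Unique xs
  unique-chain xs∈ with a , _ , refl ← ∈-map⁻ chain xs∈ = linked-unique (chain-linked a)

  -- The extra facts in `below` and `above` refute the mixed cases of `chain-disjoint`.
  data Position (a X : Subset n) : Set where
    below  : X ∈ Down.ascending a → X ∉ A → Any (X ⊆_) A → Position a X
    middle : X ≡ a → Position a X
    above  : X ∈ Up.ascending a → X ∉ A → Any (_⊆ X) A → Position a X

  position : ∀ a {X} → X ∈ chain a → Position a X
  position a p with ∈-ʳ++⁻ (Down.ascending a) p
  ... | inj₁ q = let (_ , X⊆A) , X∉A = Down.sound a q in below q X∉A X⊆A
  ... | inj₂ (here q) = middle q
  ... | inj₂ (there q) = let (_ , A⊆X) , X∉A = Up.sound a q in above q X∉A A⊆X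

  sandwiched : ∀ {X} → Any (X ⊆_) A → Any (_⊆ X) A → X ∈ A
  sandwiched X⊆A A⊆X with a , a∈ , X⊆a ← find X⊆A | b , b∈ , b⊆X ← find A⊆X
    with refl ← antichain b∈ a∈ (⊆-trans b⊆X X⊆a) = subst (_∈ A) (⊆-antisym b⊆X X⊆a) a∈

  chain-disjoint : ∀ {a b X} → a ∈ A → b ∈ A → X ∈ chain a → X ∈ chain b → a ≡ b
  chain-disjoint {a} {b} a∈ b∈ p q with position a p | position b q
  ... | below r _ _ | below s _ _ = Down.disjoint a∈ b∈ r s
  ... | above r _ _ | above s _ _ = Up.disjoint a∈ b∈ r s
  ... | middle r | middle s = trans (sym r) s
  ... | below _ X∉A r | above _ _ s = ⊥-elim (X∉A (sandwiched r s))
  ... | above _ X∉A r | below _ _ s = ⊥-elim (X∉A (sandwiched s r))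
  ... | middle refl | below _ X∉A _ = ⊥-elim (X∉A a∈)
  ... | middle refl | above _ X∉A _ = ⊥-elim (X∉A a∈)
  ... | below _ X∉A _ | middle refl = ⊥-elim (X∉A b∈)
  ... | above _ X∉A _ | middle refl = ⊥-elim (X∉A b∈)

  sound : ∀ X → X ∈ concat (map chain A) → C X
  sound X X∈ with xs , X∈xs , xs∈ ← ∈-concat⁻′ (map chain A) X∈
    with a , a∈ , refl ← ∈-map⁻ chain xs∈ with position a X∈xs
  ... | below p _ _ = proj₁ (proj₁ (Down.sound a p))
  ... | middle refl = A⊆C a∈
  ... | above p _ _ = proj₁ (proj₁ (Up.sound a p))

  place : ∀ {a X} → a ∈ A → X ∈ chain a → X ∈ concat (map chain A)
  place a∈ X∈ = ∈-concat⁺′ X∈ (∈-map⁺ chain a∈)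

  covers : ∀ X → C X → X ∈ concat (map chain A)
  covers X CX with DecMembership._∈?_ _≟ˢ_ X A
  ... | yes X∈A = place X∈A (∈-chain X)
  ... | no X∉A with any? (_⊆? X) A | any? (X ⊆?_) A
  ... | yes A⊆X | _ with a , a∈ , X∈ ← Up.covers CX A⊆X X∉A =
    place a∈ (∈-ʳ++⁺ʳ (Down.ascending a) (there X∈))
  ... | no _ | yes X⊆A with a , a∈ , X∈ ← Down.covers CX X⊆A X∉A =
    place a∈ (∈-ʳ++⁺ˡ (Down.ascending a) X∈)
  -- `X` is comparable with no element of `A`, so `X ∷ A` would be a larger antichain in `C`.
  ... | no ¬up | no ¬down = ⊥-elim (<-irrefl refl (maximum (X ∷ A) (∉⇒All≢ X∉A ∷ uniqueA)
    (λ { (here refl) → CX ; (there p) → A⊆C p })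
    λ { (here refl) (here refl) _ → refl
      ; (here refl) (there q) X⊆a → ⊥-elim (¬down (lose q X⊆a))
      ; (there p) (here refl) a⊆X → ⊥-elim (¬up (lose p a⊆X))
      ; (there p) (there q) → antichain p q }))

theorem10 : (n : ℕ) (C : Family n) → Convex C → (w : ℕ) → IsWidth C w →
    Σ (List (List (Subset n))) (λ Ps → IsSDPartition C Ps × length Ps ≡ w)
theorem10 n C convex w ((A , (uniqueA , A⊆C , antichain) , refl) , maximal) =
  map chain A ,
  (skipless ,
   Unique.concat⁺ (All.tabulate unique-chain) (unique-map⇒disjoint chain uniqueA chain-disjoint) ,
   λ X → mk⇔ (sound X) (covers X)) ,
  length-map chain A
  where
  K : ConvexWithMaximumAntichain (boolean n)
  K = record
    { C = _∈𝒞 C ; C? = λ X → C X Bool.≟ true ; convex = λ p q → convex _ _ _ p q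
    ; A = A ; uniqueA = uniqueA ; A⊆C = A⊆C ; antichain = antichain
    ; maximum = λ B u B⊆C anti → maximal B (u , B⊆C , anti) }

  open Assemble K
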